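{- For every integer $k\ge 3$, there exists a connected bipartite graph $G_k$ on which Bob wins (that is, has a winning strategy for) the connected graph coloring game with $k$ colors.
   Context: All graphs are finite, nonempty, undirected, simple and have no loops. Connected graph coloring game: given a connected graph $G$ and a set of $k$ colors, two players, Alice and Bob, alternate turns, Alice having the first move. Initially all vertices are uncolored. On their turn, the player chooses an uncolored vertex of $G$ and assigns to it one of the $k$ colors, different from the colors of all its already colored neighbors (the coloring must be proper). Moreover, except for Alice's very first move (for which she may choose any vertex), the chosen vertex must have at least one already colored neighbor; equivalently, after each turn the subgraph induced by the set of colored vertices is connected. The game stops when no legal move is available. Alice wins if and only if all the vertices of $G$ are eventually colored; otherwise Bob wins. (Equivalently, Bob wins if and only if, at some step of the game, all the $k$ colors appear in the neighborhood of some uncolored vertex.) -}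

module Defs where

open import Data.Bool.Base using (Bool)
open import Data.Fin.Base using (Fin)
open import Data.List.Base using (List; []; _∷_)
open import Data.List.Membership.Propositional using (_∈_; _∉_)
open import Data.Nat.Base using (ℕ)
open import Data.Product.Base using (Σ-syntax; ∃-syntax; _×_; _,_; proj₁; proj₂)
open import Data.Sum.Base using (_⊎_)
open import Function.Bundles using (_↔_)
open import Level using (0ℓ)
open import Relation.Binary.Construct.Closure.ReflexiveTransitive using (Star)
open import Relation.Binary.Core using (Rel)
open import Relation.Binary.Definitions using (Decidable; Irreflexive; Symmetric)
open import Relation.Binary.PropositionalEquality.Core using (_≡_; _≢_)
open import Relation.Nullary.Negation.Core using (¬_)

record Graph : Set₁ where
  field
    Vertex   : Set
    order    : ℕ
    finite   : Vertex ↔ Fin order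
    nonempty : Vertex
    Adj      : Rel Vertex 0ℓ
    adj?     : Decidable Adj
    sym      : Symmetric Adj
    irrefl   : Irreflexive _≡_ Adj

Connected : Graph → Set
Connected G = ∀ u v → Star Adj u v
  where open Graph G

Bipartite : Graph → Set
Bipartite G = Σ[ side ∈ (Vertex → Bool) ] (∀ {u v} → Adj u v → side u ≢ side v)
  where open Graph G

data Player : Set where
  alice bob : Player

module Game (G : Graph) (k : ℕ) where
  open Graph G

  Colour : Set
  Colour = Fin k

  Move : Set
  Move = Vertex × Colour

  -- The moves played so far, most recent first.  Legal moves never recolour
  -- a vertex, so v currently has colour c exactly when (v , c) ∈ h.
  History : Set
  History = List Move

  Coloured : History → Vertex → Set
  Coloured h v = ∃[ c ] (v , c) ∈ h

  AllColoured : History → Set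
  AllColoured h = ∀ v → Coloured h v

  record Legal (h : History) (m : Move) : Set where
    private
      v = proj₁ m
      c = proj₂ m
    field
      uncoloured : ¬ Coloured h v
      proper     : ∀ {u} → Adj v u → (u , c) ∉ h
      -- the history is empty only at Alice's first move
      connected  : h ≡ [] ⊎ ∃[ u ] (Adj v u × Coloured h u)

  Over : History → Set
  Over h = ∀ m → ¬ Legal h m

  Strategy : Set
  Strategy = History → Move

  -- Play σ p h: h arises with Bob following σ, and p is to move next.
  data Play (σ : Strategy) : Player → History → Set where
    start      : Play σ alice []
    alice-move : ∀ {h} m → Play σ alice h → Legal h m → Play σ bob (m ∷ h)
    bob-move   : ∀ {h} → Play σ bob h → Legal h (σ h) → Play σ alice (σ h ∷ h)

  -- Every legal play ends, since each move colours a new vertex.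
  record Winning (σ : Strategy) : Set where
    field
      legal-reply : ∀ {h} → Play σ bob h → ¬ Over h → Legal h (σ h)
      bob-wins    : ∀ {p h} → Play σ p h → Over h → ¬ AllColoured h

BobWins : Graph → ℕ → Set
BobWins G k = ∃[ σ ] Winning σ
  where open Game G k

-- Bob wins on the following graph.  On one side are a hub and many rows of
-- k + 1 cells each; on the other side are one pivot per row, adjacent to the
-- cells of its row, and many copies of a target for every k-tuple of cells,
-- adjacent to the cells of its tuple.  The hub is adjacent to all pivots and
-- targets.
--
-- Bob first gets the hub coloured, which takes him at most two moves.  To make
-- a colour c appear on a cell, he colours the pivot of an untouched row with a
-- colour other than c.  Alice's reply can spoil c for at most k cells of that
-- row, so Bob can give c to another one.  Once every colour is on a cell, an
-- uncoloured copy of the target for a tuple of such cells sees all k colours.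
module Submission where

open import Defs
open import Data.Bool.Base using (Bool; true; false)
open import Data.Empty using (⊥)
open import Data.Fin.Base using (Fin; combine; remQuot; finToFun; funToFin)
open import Data.Fin.Properties as Fin
  using (injective⇒≤; ¬∀⟶∃¬; remQuot-combine; finToFun-funToFin; +↔⊎; *↔×; 1↔⊤)
open import Data.List.Base using (List; []; _∷_; length; concatMap; tabulate; allFin)
open import Data.List.Membership.Propositional using (_∈_; _∉_; lose)
open import Data.List.Membership.Propositional.Properties
  using (∈-concatMap⁺; ∈-tabulate⁺; ∈-allFin)
import Data.List.Membership.DecPropositional as DecMembership
open import Data.List.Membership.Setoid.Properties using (index-injective)
open import Data.List.Properties using (length-++; length-tabulate)
open import Data.List.Relation.Unary.Any using (here; there; index)
open import Data.Nat.Base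
  using (ℕ; zero; suc; pred; _+_; _*_; _∸_; _^_; _≤_; _<_; _≥_; z≤n; s≤s)
open import Data.Nat.Properties
  using (≤-trans; ≤-refl; ≤-reflexive; <⇒≱; +-mono-≤; +-monoˡ-≤; +-monoʳ-≤; *-monoˡ-≤;
         m≤n+m; m≤m+n; +-comm; +-assoc; pred[m∸n]≡m∸[1+n])
open import Data.Product.Base using (Σ-syntax; ∃-syntax; _×_; _,_; proj₁; proj₂)
open import Data.Product.Properties using (≡-dec)
open import Data.Sum.Base using (_⊎_; inj₁; inj₂; [_,_]′)
open import Data.Sum.Function.Propositional using (_⊎-↔_)
open import Data.Unit.Base using (⊤; tt)
open import Function.Base using (_∘_; case_of_)
open import Function.Bundles using (_↔_; Inverse)
open import Function.Construct.Composition using (_↔-∘_)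
open import Function.Construct.Identity using (↔-id)
open import Function.Construct.Symmetry using (↔-sym)
open import Function.Properties.Inverse using (Inverse⇒Injection)
open import Relation.Binary.Construct.Closure.ReflexiveTransitive using (Star; ε; _◅_; _◅◅_)
open import Relation.Binary.Definitions using (DecidableEquality)
open import Relation.Binary.PropositionalEquality
  using (_≡_; _≢_; refl; sym; trans; cong; subst; setoid)
open import Relation.Nullary.Decidable as Dec
  using (Dec; yes; no; map′; ¬?; _×-dec_; _⊎-dec_; _→-dec_)
open import Relation.Nullary.Negation using (¬_; contradiction)

-- Counting in lists.

-- Pigeonhole: were every `x` a member, its position would inject `Fin n` into fewer than `n`
-- places.
fresh : ∀ {n} (xs : List (Fin n)) → length xs < n → ∃[ x ] x ∉ xs
fresh {n} xs xs<n = ¬∀⟶∃¬ n (_∈ xs) (_∈? xs) λ all →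
  <⇒≱ xs<n (injective⇒≤ {f = λ x → index (all x)}
    (index-injective (setoid (Fin n)) (all _) (all _)))
  where open DecMembership Fin._≟_ using (_∈?_)

length-concatMap-≤ : ∀ {A B : Set} {f : A → List B} {b} → (∀ x → length (f x) ≤ b) →
                     ∀ xs → length (concatMap f xs) ≤ length xs * b
length-concatMap-≤ f≤b [] = z≤n
length-concatMap-≤ {f = f} f≤b (x ∷ xs) =
  ≤-trans (≤-reflexive (length-++ (f x))) (+-mono-≤ (f≤b x) (length-concatMap-≤ f≤b xs))

-- Forced wins within a bounded number of moves, on any graph.

module Forcing (G : Graph) (k : ℕ) where
  open Graph G hiding (sym)
  open Game G k

  _≟ᵥ_ : DecidableEquality Vertex
  _≟ᵥ_ = Dec.via-injection (Inverse⇒Injection finite) Fin._≟_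

  _≟ₘ_ : DecidableEquality Move
  _≟ₘ_ = ≡-dec _≟ᵥ_ Fin._≟_

  open DecMembership _≟ₘ_ using (_∈?_)

  anyVertex? : {P : Vertex → Set} → (∀ v → Dec (P v)) → Dec (∃[ v ] P v)
  anyVertex? {P} P? =
    map′ (λ (i , p) → from i , p)
         (λ (v , p) → to v , subst P (sym (strictlyInverseʳ v)) p)
         (Fin.any? (P? ∘ from))
    where open Inverse finite

  allVertices? : {P : Vertex → Set} → (∀ v → Dec (P v)) → Dec (∀ v → P v)
  allVertices? {P} P? =
    map′ (λ p v → subst P (strictlyInverseʳ v) (p (to v)))
         (λ p i → p (from i))
         (Fin.all? (P? ∘ from))
    where open Inverse finite

  anyMove? : {P : Move → Set} → (∀ m → Dec (P m)) → Dec (∃[ m ] P m)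
  anyMove? P? =
    map′ (λ (v , c , p) → (v , c) , p) (λ ((v , c) , p) → v , c , p)
         (anyVertex? λ v → Fin.any? λ c → P? (v , c))

  allMoves? : {P : Move → Set} → (∀ m → Dec (P m)) → Dec (∀ m → P m)
  allMoves? P? =
    map′ (λ p (v , c) → p v c) (λ p v c → p (v , c))
         (allVertices? λ v → Fin.all? λ c → P? (v , c))

  coloured? : ∀ h v → Dec (Coloured h v)
  coloured? h v = Fin.any? λ c → (v , c) ∈? h

  empty? : (h : History) → Dec (h ≡ [])
  empty? [] = yes refl
  empty? (_ ∷ _) = no λ ()

  legal? : ∀ h m → Dec (Legal h m)
  legal? h (v , c) =
    map′ (λ (u , p , a) → record { uncoloured = u ; proper = p _ ; connected = a })
         (λ l → Legal.uncoloured l , (λ _ → Legal.proper l) , Legal.connected l)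
         (¬? (coloured? h v)
           ×-dec allVertices? (λ u → adj? v u →-dec ¬? ((u , c) ∈? h))
           ×-dec (empty? h ⊎-dec anyVertex? λ u → adj? v u ×-dec coloured? h u))

  Doomed : History → Set
  Doomed h = ∃[ v ] (¬ Coloured h v × (∀ c → ∃[ u ] (Adj v u × (u , c) ∈ h)))

  doomed? : ∀ h → Dec (Doomed h)
  doomed? h = anyVertex? λ v → ¬? (coloured? h v) ×-dec
    Fin.all? λ c → anyVertex? λ u → adj? v u ×-dec (u , c) ∈? h

  -- A move at `v` itself would be improper, since every colour already occurs next to `v`.
  doomed-∷ : ∀ {h m} → Doomed h → Legal h m → Doomed (m ∷ h)
  doomed-∷ (v , v∉h , surrounded) legal =
    v ,
    (λ { (c , here refl) → let (u , v~u , u∈h) = surrounded c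
                           in Legal.proper legal v~u u∈h
       ; (c , there v∈h) → v∉h (c , v∈h) }) ,
    λ c → let (u , v~u , u∈h) = surrounded c in u , v~u , there u∈h

  -- Bob, with p to move after h, can doom a vertex within n further moves.
  Forces : ℕ → Player → History → Set
  Forces zero p h = Doomed h
  Forces (suc n) alice h =
    Doomed h ⊎ (¬ AllColoured h × (∀ m → Legal h m → Forces n bob (m ∷ h)))
  Forces (suc n) bob h =
    Doomed h ⊎ ∃[ m ] (Legal h m × Forces n alice (m ∷ h))

  -- A `Strategy` is a function of the history, so Bob's move is found by search, which requires
  -- this decision procedure.
  forces? : ∀ n p h → Dec (Forces n p h)
  forces? zero p h = doomed? h
  forces? (suc n) alice h = doomed? h ⊎-dec
    (¬? (allVertices? (coloured? h)) ×-dec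
      allMoves? λ m → legal? h m →-dec forces? n bob (m ∷ h))
  forces? (suc n) bob h = doomed? h ⊎-dec
    anyMove? λ m → legal? h m ×-dec forces? n alice (m ∷ h)

  doomed⇒forces : ∀ n {p h} → Doomed h → Forces n p h
  doomed⇒forces zero d = d
  doomed⇒forces (suc n) {alice} d = inj₁ d
  doomed⇒forces (suc n) {bob} d = inj₁ d

  forces-mono : ∀ {m n} → m ≤ n → ∀ {p h} → Forces m p h → Forces n p h
  forces-mono {n = n} z≤n d = doomed⇒forces n d
  forces-mono (s≤s m≤n) {alice} (inj₁ d) = inj₁ d
  forces-mono (s≤s m≤n) {alice} (inj₂ (¬all , reply)) =
    inj₂ (¬all , λ m l → forces-mono m≤n (reply m l))
  forces-mono (s≤s m≤n) {bob} (inj₁ d) = inj₁ d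
  forces-mono (s≤s m≤n) {bob} (inj₂ (m , l , f)) = inj₂ (m , l , forces-mono m≤n f)

  forces-alice : ∀ n {h m} → Forces n alice h → Legal h m → Forces (pred n) bob (m ∷ h)
  forces-alice zero d l = doomed-∷ d l
  forces-alice (suc n) (inj₁ d) l = doomed⇒forces n (doomed-∷ d l)
  forces-alice (suc n) (inj₂ (_ , reply)) l = reply _ l

  -- Bob must reply legally even when the outcome is settled; any legal move then serves, as doom
  -- persists.
  doomed-bob : ∀ n {h} → Doomed h → ¬ Over h →
               ∃[ m ] (Legal h m × Forces n alice (m ∷ h))
  doomed-bob n {h} d ¬over with anyMove? (legal? h)
  ... | yes (m , l) = m , l , doomed⇒forces n (doomed-∷ d l)
  ... | no ¬move = contradiction (λ m l → ¬move (m , l)) ¬over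

  forces-bob : ∀ n {h} → Forces n bob h → ¬ Over h →
               ∃[ m ] (Legal h m × Forces (pred n) alice (m ∷ h))
  forces-bob zero d = doomed-bob zero d
  forces-bob (suc n) (inj₁ d) = doomed-bob n d
  forces-bob (suc n) (inj₂ move) _ = move

  -- If Alice has no move, the quantification over her replies is vacuous, which is why her clause
  -- of `Forces` carries `¬ AllColoured`. Bob's clause supplies a legal move, against `Over`.
  forces⇒incomplete : ∀ n p {h} → Forces n p h → Over h → ¬ AllColoured h
  forces⇒incomplete zero p (v , v∉h , _) _ all = v∉h (all v)
  forces⇒incomplete (suc n) alice (inj₁ (v , v∉h , _)) _ all = v∉h (all v)
  forces⇒incomplete (suc n) alice (inj₂ (¬all , _)) _ = ¬all
  forces⇒incomplete (suc n) bob (inj₁ (v , v∉h , _)) _ all = v∉h (all v)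
  forces⇒incomplete (suc n) bob (inj₂ (m , l , _)) over = contradiction l (over m)

  module _ (N : ℕ) (c₀ : Colour) (opening : Forces N alice []) where

    -- The budget is read off from the length of the history, so `strategy` needs no other memory.
    -- Truncated subtraction keeps it at 0, where `Forces` means `Doomed`, once the play outlasts
    -- `N`.
    Good : History → Move → Set
    Good h m = Legal h m × Forces (N ∸ suc (length h)) alice (m ∷ h)

    good? : ∀ h → Dec (∃[ m ] Good h m)
    good? h = anyMove? λ m → legal? h m ×-dec forces? _ alice (m ∷ h)

    strategy : Strategy
    strategy h with good? h
    ... | yes (m , _) = m
    -- An arbitrary default: `play-forces` and `bob-good` rule it out whenever Bob is to move in an
    -- unfinished play that follows `strategy`.
    ... | no _ = nonempty , c₀

    strategy-good : ∀ h → ∃[ m ] Good h m → Good h (strategy h)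
    strategy-good h move with good? h
    ... | yes (_ , good) = good
    ... | no ¬good = contradiction move ¬good

    bob-good : ∀ {h} → Forces (N ∸ length h) bob h → ¬ Over h → Good h (strategy h)
    bob-good {h} f ¬over =
      let (m , l , f′) = forces-bob (N ∸ length h) f ¬over
      in strategy-good h
           (m , l , subst (λ n → Forces n alice (m ∷ h)) (pred[m∸n]≡m∸[1+n] N (length h)) f′)

    play-forces : ∀ {p h} → Play strategy p h → Forces (N ∸ length h) p h
    play-forces start = opening
    play-forces (alice-move {h} m play l) =
      subst (λ n → Forces n bob (m ∷ h)) (pred[m∸n]≡m∸[1+n] N (length h))
        (forces-alice (N ∸ length h) (play-forces play) l)
    play-forces (bob-move {h} play l) =
      -- The legality of the move just made shows that the game was not over before it.
      proj₂ (bob-good (play-forces play) λ over → over (strategy h) l)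

    forces⇒bobWins : BobWins G k
    forces⇒bobWins = strategy , record
      { legal-reply = λ play ¬over → proj₁ (bob-good (play-forces play) ¬over)
      ; bob-wins = λ {p} {h} play → forces⇒incomplete (N ∸ length h) p (play-forces play)
      }

-- The graph: finiteness, connectedness, bipartiteness.

module Construction (k : ℕ) (3≤k : 3 ≤ k) where

  -- At most 5 moves are played until it is Bob's turn with the hub coloured, and
  -- then 4 for each colour; every move touches at most k + 1 rows.
  duration rows width : ℕ
  duration = 5 + k * 4
  rows = suc (duration * suc k)
  width = suc k

  Cell : Set
  Cell = Fin rows × Fin width

  -- Numbers stand for `k`-tuples of cells, since counting functions `Fin k → Cell` up to `≡` would
  -- call for extensionality.
  Code : Set
  Code = Fin ((rows * width) ^ k)

  entry : Code → Fin k → Cell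
  entry w i = remQuot width (finToFun w i)

  encode : (Fin k → Cell) → Code
  encode f = funToFin λ i → combine (proj₁ (f i)) (proj₂ (f i))

  entry-encode : ∀ f i → entry (encode f) i ≡ f i
  entry-encode f i =
    trans (cong (remQuot width) (finToFun-funToFin _ i)) (remQuot-combine _ _)

  Left Right V : Set
  Left = ⊤ ⊎ Cell
  Right = Fin rows ⊎ (Fin rows × Code)
  V = Left ⊎ Right

  pattern hub = inj₁ (inj₁ tt)
  pattern cell a = inj₁ (inj₂ a)
  pattern pivot j = inj₂ (inj₁ j)
  pattern target t w = inj₂ (inj₂ (t , w))

  Link : Left → Right → Set
  Link (inj₁ tt) _ = ⊤
  Link (inj₂ a) (inj₁ j) = proj₁ a ≡ j
  Link (inj₂ a) (inj₂ (_ , w)) = ∃[ i ] a ≡ entry w i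

  link? : ∀ l r → Dec (Link l r)
  link? (inj₁ tt) _ = yes tt
  link? (inj₂ a) (inj₁ j) = proj₁ a Fin.≟ j
  link? (inj₂ a) (inj₂ (_ , w)) = Fin.any? λ i → ≡-dec Fin._≟_ Fin._≟_ a (entry w i)

  Edge : V → V → Set
  Edge (inj₁ l) (inj₂ r) = Link l r
  Edge (inj₂ r) (inj₁ l) = Link l r
  Edge _ _ = ⊥

  edge? : ∀ u v → Dec (Edge u v)
  edge? (inj₁ l) (inj₁ _) = no λ ()
  edge? (inj₁ l) (inj₂ r) = link? l r
  edge? (inj₂ r) (inj₁ l) = link? l r
  edge? (inj₂ r) (inj₂ _) = no λ ()

  edge-sym : ∀ {u v} → Edge u v → Edge v u
  edge-sym {inj₁ _} {inj₂ _} e = e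
  edge-sym {inj₂ _} {inj₁ _} e = e

  edge-irrefl : ∀ {u v} → u ≡ v → ¬ Edge u v
  edge-irrefl {inj₁ _} refl ()
  edge-irrefl {inj₂ _} refl ()

  V-finite : V ↔ Fin ((1 + rows * width) + (rows + rows * (rows * width) ^ k))
  V-finite = ↔-sym
    ((((1↔⊤ ⊎-↔ *↔×) ↔-∘ +↔⊎) ⊎-↔ ((↔-id _ ⊎-↔ *↔×) ↔-∘ +↔⊎)) ↔-∘ +↔⊎)

  G : Graph
  G = record
    { Vertex = V ; finite = V-finite ; nonempty = hub
    ; Adj = Edge ; adj? = edge? ; sym = λ {u} {v} → edge-sym {u} {v}
    ; irrefl = λ {u} {v} → edge-irrefl {u} {v} }

  toHub : ∀ v → Star Edge v hub
  toHub hub = ε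
  toHub (cell a) = _◅_ {j = pivot (proj₁ a)} refl (tt ◅ ε)
  toHub (inj₂ r) = tt ◅ ε

  fromHub : ∀ v → Star Edge hub v
  fromHub hub = ε
  fromHub (cell a) = _◅_ {j = pivot (proj₁ a)} tt (refl ◅ ε)
  fromHub (inj₂ r) = tt ◅ ε

  connected : Connected G
  connected u v = toHub u ◅◅ fromHub v

  bipartite : Bipartite G
  bipartite = side , λ {u} {v} → sides {u} {v}
    where
    side : V → Bool
    side = [ (λ _ → true) , (λ _ → false) ]′

    sides : ∀ {u v} → Edge u v → side u ≢ side v
    sides {inj₁ _} {inj₂ _} _ ()
    sides {inj₂ _} {inj₁ _} _ ()

  -- Untouched rows, colours on cells, and the colour of the hub.

  open Game G k
  open Forcing G k

  -- For a target, the index of the copy counts as well as the rows it meets.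
  touchedRows : V → List (Fin rows)
  touchedRows hub = []
  touchedRows (cell a) = proj₁ a ∷ []
  touchedRows (pivot j) = j ∷ []
  touchedRows (target t w) = t ∷ tabulate (proj₁ ∘ entry w)

  -- Rows are disregarded: excluding too many columns is harmless, as one vertex excludes at most
  -- `k` of the `k + 1`.
  touchedColumns : V → List (Fin width)
  touchedColumns (cell a) = proj₂ a ∷ []
  touchedColumns (target t w) = tabulate (proj₂ ∘ entry w)
  touchedColumns _ = []

  length-touchedRows : ∀ v → length (touchedRows v) ≤ suc k
  length-touchedRows hub = z≤n
  length-touchedRows (cell a) = s≤s z≤n
  length-touchedRows (pivot j) = s≤s z≤n
  length-touchedRows (target t w) = s≤s (≤-reflexive (length-tabulate (proj₁ ∘ entry w)))

  length-touchedColumns : ∀ v → length (touchedColumns v) ≤ k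
  length-touchedColumns hub = z≤n
  length-touchedColumns (cell a) = ≤-trans (s≤s z≤n) 3≤k
  length-touchedColumns (pivot j) = z≤n
  length-touchedColumns (target t w) = ≤-reflexive (length-tabulate (proj₂ ∘ entry w))

  -- In such a row the pivot and all cells are uncoloured, no coloured target is adjacent to a cell,
  -- and copy `j` of every target is uncoloured.
  Untouched : History → Fin rows → Set
  Untouched h j = ∀ {v c} → (v , c) ∈ h → j ∉ touchedRows v

  untouchedRow : ∀ h → length h ≤ duration → ∃[ j ] Untouched h j
  untouchedRow h h≤d =
    let (j , j∉) = fresh (concatMap (touchedRows ∘ proj₁) h)
          (s≤s (≤-trans (length-concatMap-≤ (length-touchedRows ∘ proj₁) h)
                        (*-monoˡ-≤ (suc k) h≤d)))
    in j , λ v∈h j∈v → j∉ (∈-concatMap⁺ (touchedRows ∘ proj₁) (lose v∈h j∈v))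

  untouchedColumn : ∀ v → ∃[ i ] i ∉ touchedColumns v
  untouchedColumn v = fresh (touchedColumns v) (s≤s (length-touchedColumns v))

  -- The pivot of an untouched row is still uncoloured. This discharges the `¬ AllColoured` clause
  -- at Alice's turns.
  incomplete : ∀ h → length h ≤ duration → ¬ AllColoured h
  incomplete h h≤d all =
    let (j , j-free) = untouchedRow h h≤d
        (_ , pivot∈h) = all (pivot j)
    in j-free pivot∈h (here refl)

  colourExcept : ∀ c d → ∃[ e ] (e ≢ c × e ≢ d)
  colourExcept c d =
    let (e , e∉) = fresh (c ∷ d ∷ []) 3≤k
    in e , (λ e≡c → e∉ (here e≡c)) , λ e≡d → e∉ (there (here e≡d))

  Seen : History → Colour → Set
  Seen h c = ∃[ a ] (cell a , c) ∈ h

  -- Copies of targets are indexed by rows, so an untouched row also yields an uncoloured copy.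
  allSeen⇒doomed : ∀ h → length h ≤ duration → (∀ c → Seen h c) → Doomed h
  allSeen⇒doomed h h≤d seen with untouchedRow h h≤d
  ... | t , t-free = target t (encode (proj₁ ∘ seen)) , (λ (_ , p) → t-free p (here refl)) ,
    λ c → cell (proj₁ (seen c)) , (c , sym (entry-encode (proj₁ ∘ seen) c)) , proj₂ (seen c)

  -- Uniqueness makes later pivot moves proper; a bare `History` could list the hub twice.
  HubColour : History → Colour → Set
  HubColour h c = (hub , c) ∈ h × (∀ {d} → (hub , d) ∈ h → d ≡ c)

  hubColour-here : ∀ {h c} → ¬ Coloured h hub → HubColour ((hub , c) ∷ h) c
  hubColour-here hub∉h = here refl , λ where
    (here eq) → cong proj₂ eq
    (there p) → contradiction (_ , p) hub∉h

  hubColour-∷ : ∀ {h m c} → HubColour h c → Legal h m → HubColour (m ∷ h) c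
  hubColour-∷ (p , unique) l = there p , λ where
    (here refl) → contradiction (_ , p) (Legal.uncoloured l)
    (there q) → unique q

  -- Bob's play on this graph.

  rotate : ∀ n l → 4 + n + l ≡ n + (4 + l)
  rotate n l = trans (cong (_+ l) (+-comm 4 n)) (+-assoc n 4 l)

  -- Induction on `cs`, which contains every colour not yet on a cell. Each colour costs a round of
  -- four moves: pivot, Alice's reply, cell, Alice's reply. The bound by `duration` keeps untouched
  -- rows available to the end.
  forces-from-missing : ∀ cs h {c₀} → HubColour h c₀ → (∀ c → c ∈ cs ⊎ Seen h c) →
    length cs * 4 + length h ≤ duration → Forces (length cs * 4) bob h
  forces-from-missing [] h hubc seen h≤d =
    allSeen⇒doomed h h≤d λ c → case seen c of λ { (inj₂ s) → s }
  forces-from-missing (c ∷ cs) h {c₀} hubc@(hub∈h , hub-unique) seen h≤d =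
    inj₂ ((pivot j , d) , legal₁ , inj₂ (incomplete h₁ (within 1 (s≤s z≤n)) , afterAlice))
    where
    within : ∀ i → i ≤ 4 → i + length h ≤ duration
    within i i≤4 = ≤-trans (+-monoˡ-≤ (length h) (≤-trans i≤4 (m≤m+n 4 (length cs * 4)))) h≤d

    row = untouchedRow h (within 0 z≤n)
    j = proj₁ row
    j-free : Untouched h j
    j-free = proj₂ row

    -- `d` avoids `c₀` because the hub is adjacent to the pivot, and avoids `c` so that `c` stays
    -- available on the row.
    choice = colourExcept c c₀
    d = proj₁ choice
    d≢c = proj₁ (proj₂ choice)
    d≢c₀ = proj₂ (proj₂ choice)

    h₁ = (pivot j , d) ∷ h

    proper₁ : ∀ {u} → Edge (pivot j) u → (u , d) ∉ h
    proper₁ {hub} _ p = d≢c₀ (hub-unique p)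
    proper₁ {cell a} refl p = j-free p (here refl)

    legal₁ : Legal h (pivot j , d)
    legal₁ = record
      { uncoloured = λ (_ , p) → j-free p (here refl)
      ; proper = λ {u} → proper₁ {u}
      ; connected = inj₂ (hub , tt , c₀ , hub∈h) }

    afterAlice : ∀ m → Legal h₁ m → Forces (2 + length cs * 4) bob (m ∷ h₁)
    afterAlice m@(x , e) l =
      inj₂ ((cell (j , i) , c) , legal₃ ,
            inj₂ (incomplete h₃ (within 3 (s≤s (s≤s (s≤s z≤n)))) , λ m′ l′ →
        forces-from-missing cs (m′ ∷ h₃)
          (hubColour-∷ (hubColour-∷ (hubColour-∷ (hubColour-∷ hubc legal₁) l) legal₃) l′)
          seen′
          (≤-trans (≤-reflexive (sym (rotate (length cs * 4) (length h)))) h≤d)))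
      where
      -- Chosen after Alice's reply: the new cell is not `x`, nor adjacent to `x` if `x` is a
      -- target.
      column = untouchedColumn x
      i = proj₁ column
      i-free : i ∉ touchedColumns x
      i-free = proj₂ column

      h₂ = m ∷ h₁
      h₃ = (cell (j , i) , c) ∷ h₂

      uncoloured₃ : ¬ Coloured h₂ (cell (j , i))
      uncoloured₃ (_ , here eq) =
        i-free (subst (λ v → i ∈ touchedColumns v) (cong proj₁ eq) (here refl))
      uncoloured₃ (_ , there (there p)) = j-free p (here refl)

      -- The only coloured neighbour is the cell's own pivot, of colour `d`: moves in `h` miss row
      -- `j`, and a target `x` misses column `i`.
      proper₃ : ∀ {u} → Edge (cell (j , i)) u → (u , c) ∉ h₂
      proper₃ {pivot _} refl (here refl) = Legal.uncoloured l (_ , here refl)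
      proper₃ {pivot _} refl (there (here eq)) = d≢c (sym (cong proj₂ eq))
      proper₃ {pivot _} refl (there (there p)) = j-free p (here refl)
      proper₃ {target t w} (n , eq) (here refl) =
        i-free (subst (_∈ touchedColumns x) (sym (cong proj₂ eq)) (∈-tabulate⁺ n))
      proper₃ {target t w} (n , eq) (there (there p)) =
        j-free p (there (subst (_∈ tabulate (proj₁ ∘ entry w)) (sym (cong proj₁ eq))
                               (∈-tabulate⁺ n)))

      legal₃ : Legal h₂ (cell (j , i) , c)
      legal₃ = record
        { uncoloured = uncoloured₃
        ; proper = λ {u} → proper₃ {u}
        ; connected = inj₂ (pivot j , refl , d , there (here refl)) }

      seen′ : ∀ {m′} a → a ∈ cs ⊎ Seen (m′ ∷ h₃) a
      seen′ a with seen a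
      ... | inj₁ (here refl) = inj₂ (_ , there (here refl))
      ... | inj₁ (there a∈cs) = inj₁ a∈cs
      ... | inj₂ (b , p) = inj₂ (b , there (there (there (there p))))

  -- All colours are listed as missing, even those already on cells; the 5 in `duration` covers the
  -- moves made so far.
  forces-from-hub : ∀ {h c₀} → HubColour h c₀ → length h ≤ 5 → Forces (k * 4) bob h
  forces-from-hub {h} hubc h≤5 =
    subst (λ n → Forces (n * 4) bob h) len
      (forces-from-missing (allFin k) h hubc (λ c → inj₁ (∈-allFin c))
        (subst (λ n → n * 4 + length h ≤ duration) (sym len)
          (≤-trans (+-monoʳ-≤ (k * 4) h≤5) (≤-reflexive (+-comm (k * 4) 5)))))
    where
    len : length (allFin k) ≡ k
    len = length-tabulate (λ c → c)

  -- Bob colours the hub and Alice replies: hence the 2, and at most 3 moves before. The slack `n`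
  -- serves openings of different lengths.
  colourHub : ∀ n h e → Legal h (hub , e) → length h ≤ 3 → Forces (2 + (n + k * 4)) bob h
  colourHub n h e l h≤3 = inj₂ ((hub , e) , l ,
    inj₂ (incomplete _ (≤-trans (s≤s h≤3) (m≤m+n 4 (suc (k * 4)))) , λ m l′ →
      forces-mono (m≤n+m (k * 4) n)
        (forces-from-hub (hubColour-∷ (hubColour-here (Legal.uncoloured l)) l′) (s≤s (s≤s h≤3)))))

  opening : Forces duration alice []
  opening = inj₂ (incomplete [] z≤n , first)
    where
    first : ∀ m → Legal [] m → Forces (4 + k * 4) bob (m ∷ [])
    first (hub , c) l =
      forces-mono (m≤n+m (k * 4) 4)
        (forces-from-hub (hubColour-here (Legal.uncoloured l)) (s≤s z≤n))
    first (inj₂ r , c) _ = colourHub 2 _ d legal (s≤s z≤n)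
      where
      choice = colourExcept c c
      d = proj₁ choice
      legal : Legal ((inj₂ r , c) ∷ []) (hub , d)
      legal = record
        { uncoloured = λ { (_ , here ()) }
        ; proper = λ { _ (here eq) → proj₁ (proj₂ choice) (cong proj₂ eq) }
        ; connected = inj₂ (inj₂ r , tt , c , here refl) }
    -- The hub is not adjacent to a cell, so Bob goes through the pivot. This gives the longest
    -- opening: cell, pivot, reply, hub, reply.
    first (cell a , c) _ =
      inj₂ ((pivot (proj₁ a) , d) , legal₁ , inj₂ (incomplete h₁ (s≤s (s≤s z≤n)) , second))
      where
      choice = colourExcept c c
      d = proj₁ choice
      h₁ = (pivot (proj₁ a) , d) ∷ (cell a , c) ∷ []

      legal₁ : Legal ((cell a , c) ∷ []) (pivot (proj₁ a) , d)
      legal₁ = record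
        { uncoloured = λ { (_ , here ()) }
        ; proper = λ { _ (here eq) → proj₁ (proj₂ choice) (cong proj₂ eq) }
        ; connected = inj₂ (cell a , refl , c , here refl) }

      hubUncoloured : ∀ x e → x ≢ hub → Forces (2 + k * 4) bob ((x , e) ∷ h₁)
      hubUncoloured x e x≢hub = colourHub 0 ((x , e) ∷ h₁) f legal ≤-refl
        where
        -- The cell `a` is on the hub's side, so only the pivot's `d` and Alice's `e` need avoiding.
        choice′ = colourExcept d e
        f = proj₁ choice′
        proper : ∀ {u} → Edge hub u → (u , f) ∉ (x , e) ∷ h₁
        proper _ (here eq) = proj₂ (proj₂ choice′) (cong proj₂ eq)
        proper _ (there (here eq)) = proj₁ (proj₂ choice′) (cong proj₂ eq)
        proper {inj₂ _} _ (there (there (here ())))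

        legal : Legal ((x , e) ∷ h₁) (hub , f)
        legal = record
          { uncoloured = λ { (_ , here eq) → x≢hub (cong proj₁ (sym eq))
                           ; (_ , there (there (there ()))) }
          ; proper = λ {u} → proper {u}
          ; connected = inj₂ (pivot (proj₁ a) , tt , d , there (here refl)) }

      second : ∀ m → Legal h₁ m → Forces (2 + k * 4) bob (m ∷ h₁)
      second (hub , e) l = forces-mono (m≤n+m (k * 4) 2)
        (forces-from-hub (hubColour-here (Legal.uncoloured l)) (s≤s (s≤s (s≤s z≤n))))
      second (cell b , e) _ = hubUncoloured (cell b) e λ ()
      second (inj₂ r , e) _ = hubUncoloured (inj₂ r) e λ ()

  bobWins : BobWins G k
  bobWins = forces⇒bobWins duration (proj₁ (fresh [] (≤-trans (s≤s z≤n) 3≤k))) opening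

theorem4 : ∀ (k : ℕ) → k ≥ 3 → Σ[ G ∈ Graph ] (Connected G × Bipartite G × BobWins G k)
theorem4 k k≥3 = G , connected , bipartite , bobWins
  where open Construction k k≥3
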